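{- For every integer $n\ge 1$, there is an $n$-barely random algorithm for metrical task systems on the uniform metric space of cardinality $n$ that is $(2H_n+6)$-competitive, where $H_n=\sum_{i=1}^n 1/i$ is the $n$-th harmonic number.
   Context: The uniform metric space of cardinality $n$ is a set $X$ with $|X|=n$ and $d(\rho,\rho')=1$ for all $\rho\ne\rho'$. Metrical task systems (MTS) on a finite metric space $(X,d)$: the input is a sequence of cost vectors $c=(c(t))_{t\ge 1}$ with $c(t)\in\mathbb{R}_+^X$; the output is a sequence of states $\rho=(\rho(t))_{t\ge 0}$ in $X$. Its cost is $\mathrm{Cost}(\rho,c)=\sum_{t\ge 1}\big(d(\rho(t-1),\rho(t))+c_{\rho(t)}(t)\big)$, and $\mathrm{OPT}(c)=\inf_{\rho\in X^{\mathbb{N}}}\mathrm{Cost}(\rho,c)$. A $k$-barely random algorithm $\mathcal{A}$ draws one seed $s$ uniformly from $\{1,\dots,k\}$ and outputs $\rho_{\mathcal A}(t)=\mathcal{A}(c(1),\dots,c(t),s)$ for all $t\ge 0$. It is $\alpha$-competitive if there is a constant $\beta\in\mathbb{R}$ such that $\mathbb{E}_{s}[\mathrm{Cost}(\rho_{\mathcal A},c)]\le\alpha\,\mathrm{OPT}(c)+\beta$ for every cost sequence $c$. -}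

module Defs where

open import Level using (0ℓ)
open import Algebra.Bundles using (RawMonoid)
open import Algebra.Structures using (IsCommutativeRing)
import Algebra.Definitions.RawMonoid as RawMonoidDefs
open import Axiom.ExcludedMiddle using (ExcludedMiddle)
open import Data.Fin.Base using (Fin; toℕ)
open import Data.List.Base using (List; applyUpTo)
open import Data.Nat.Base using (ℕ; zero; suc)
open import Data.Product.Base using (∃; _,_; proj₁; proj₂; _×_)
open import Function.Bundles using (_↔_)
import Function.Metric.Structures as Metric
open import Relation.Binary.Core using (Rel)
open import Relation.Binary.PropositionalEquality using (_≡_; _≢_; refl)
open import Relation.Binary.Structures using (IsTotalOrder)
import Relation.Binary.Construct.Add.Supremum.NonStrict as AddSupremum
open import Relation.Nullary.Construct.Add.Supremum using (_⁺; [_]; ⊤⁺)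
open import Relation.Nullary.Decidable.Core using (yes; no)
open import Relation.Unary using (Pred; Satisfiable)

-- The real numbers, axiomatised as a Dedekind-complete ordered field (which
-- determines them up to isomorphism).  The value of 0# ⁻¹ is unspecified.

record CompleteOrderedField : Set₁ where
  infix  8 _⁻¹
  infix  8 -_
  infixl 7 _*_
  infixl 6 _+_
  infix  4 _≤_
  field
    ℝ     : Set
    _+_   : ℝ → ℝ → ℝ
    _*_   : ℝ → ℝ → ℝ
    -_    : ℝ → ℝ
    0#    : ℝ
    1#    : ℝ
    _⁻¹   : ℝ → ℝ
    _≤_   : Rel ℝ 0ℓ

    isCommutativeRing : IsCommutativeRing _≡_ _+_ _*_ -_ 0# 1#
    0≢1               : 0# ≢ 1#
    *-inverseʳ        : ∀ x → x ≢ 0# → x * x ⁻¹ ≡ 1#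

    isTotalOrder      : IsTotalOrder _≡_ _≤_
    +-monoˡ-≤         : ∀ z {x y} → x ≤ y → x + z ≤ y + z
    *-nonNegative     : ∀ {x y} → 0# ≤ x → 0# ≤ y → 0# ≤ x * y

  UpperBound : Pred ℝ 0ℓ → Pred ℝ 0ℓ
  UpperBound P b = ∀ {x} → P x → x ≤ b

  LeastUpperBound : Pred ℝ 0ℓ → Pred ℝ 0ℓ
  LeastUpperBound P s = UpperBound P s × (∀ {b} → UpperBound P b → s ≤ b)

  field
    complete : (P : Pred ℝ 0ℓ) → Satisfiable P → Satisfiable (UpperBound P) →
               ∃ (LeastUpperBound P)

  +-rawMonoid : RawMonoid 0ℓ 0ℓ
  +-rawMonoid = record { Carrier = ℝ ; _≈_ = _≡_ ; _∙_ = _+_ ; ε = 0# }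

  private module ℝSum = RawMonoidDefs +-rawMonoid

  fromℕ : ℕ → ℝ
  fromℕ n = n ℝSum.× 1#

  H : ℕ → ℝ
  H n = ℝSum.sum {n} (λ i → fromℕ (suc (toℕ i)) ⁻¹)

-- Costs of infinite sequences live in ℝ ⁺ = ℝ ∪ {+∞}, with ⊤⁺ as +∞.  Excluded
-- middle is what makes suprema and infima in ℝ ⁺ total operations.

module ExtendedReals (em : ExcludedMiddle 0ℓ) (F : CompleteOrderedField) where
  open CompleteOrderedField F
  open AddSupremum _≤_ public using (_≤⁺_; [_]; _≤⊤⁺)

  infixl 7 _*⁺_
  infixl 6 _+⁺_

  _+⁺_ : ℝ ⁺ → ℝ ⁺ → ℝ ⁺
  [ x ] +⁺ [ y ] = [ x + y ]
  [ x ] +⁺ ⊤⁺    = ⊤⁺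
  ⊤⁺    +⁺ y     = ⊤⁺

  -- Only meant for positive scalars, for which a · (+∞) = +∞.
  _*⁺_ : ℝ → ℝ ⁺ → ℝ ⁺
  a *⁺ [ x ] = [ a * x ]
  a *⁺ ⊤⁺    = ⊤⁺

  +⁺-rawMonoid : RawMonoid 0ℓ 0ℓ
  +⁺-rawMonoid = record { Carrier = ℝ ⁺ ; _≈_ = _≡_ ; _∙_ = _+⁺_ ; ε = [ 0# ] }

  open RawMonoidDefs +⁺-rawMonoid public using () renaming (sum to sum⁺)

  sup : (P : Pred ℝ 0ℓ) → Satisfiable P → ℝ ⁺
  sup P ne with em {P = Satisfiable (UpperBound P)}
  ... | yes bounded = [ proj₁ (complete P ne bounded) ]
  ... | no  _       = ⊤⁺

  sup-upper : (P : Pred ℝ 0ℓ) (ne : Satisfiable P) → ∀ {x} → P x → [ x ] ≤⁺ sup P ne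
  sup-upper P ne Px with em {P = Satisfiable (UpperBound P)}
  ... | yes bounded = [ proj₁ (proj₂ (complete P ne bounded)) Px ]
  ... | no  _       = _ ≤⊤⁺

  LowerBound : {I : Set} → (I → ℝ ⁺) → Pred ℝ 0ℓ
  LowerBound f y = ∀ i → [ y ] ≤⁺ f i

  -- The infimum is the supremum of the real lower bounds; it is +∞ exactly when
  -- f is constantly +∞.
  inf : {I : Set} (f : I → ℝ ⁺) → Satisfiable (LowerBound f) → ℝ ⁺
  inf f bounded = sup (LowerBound f) bounded

module MTS (em : ExcludedMiddle 0ℓ) (F : CompleteOrderedField) where
  open CompleteOrderedField F
  open ExtendedReals em F

  record FiniteMetricSpace (n : ℕ) : Set₁ where
    field
      X           : Set
      cardinality : X ↔ Fin n
      d           : X → X → ℝ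
      isMetric    : Metric.IsGeneralMetric _≡_ _≡_ _≤_ 0# _+_ d

  IsUniform : ∀ {n} → FiniteMetricSpace n → Set
  IsUniform M = ∀ {x y} → x ≢ y → d x y ≡ 1#
    where open FiniteMetricSpace M

  module _ {n : ℕ} (M : FiniteMetricSpace n) where
    open FiniteMetricSpace M

    CostVector : Set
    CostVector = X → ℝ

    -- Cost vectors are indexed from 0: c t is the vector revealed at time t + 1.
    -- States are indexed from time 0, so c t is paid in state ρ (suc t).
    CostSequence : Set
    CostSequence = ℕ → CostVector

    StateSequence : Set
    StateSequence = ℕ → X

    NonNegative : CostSequence → Set
    NonNegative c = ∀ t x → 0# ≤ c t x

    partialCost : StateSequence → CostSequence → ℕ → ℝ
    partialCost ρ c zero    = 0#
    partialCost ρ c (suc T) =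
      partialCost ρ c T + (d (ρ T) (ρ (suc T)) + c T (ρ (suc T)))

    -- The infinite series has nonnegative terms (for nonnegative c), so its sum
    -- is the supremum of its partial sums.
    Cost : StateSequence → CostSequence → ℝ ⁺
    Cost ρ c = sup (λ x → ∃ λ T → x ≡ partialCost ρ c T) (0# , 0 , refl)

    OPT : CostSequence → ℝ ⁺
    OPT c = inf (λ ρ → Cost ρ c) (0# , λ ρ → sup-upper _ _ (0 , refl))

    -- The list holds the cost vectors revealed so far, oldest first.
    BarelyRandomAlgorithm : ℕ → Set
    BarelyRandomAlgorithm k = List CostVector → Fin k → X

    output : ∀ {k} → BarelyRandomAlgorithm k → CostSequence → Fin k → StateSequence
    output A c s t = A (applyUpTo c t) s

    expectedCost : ∀ {k} → BarelyRandomAlgorithm k → CostSequence → ℝ ⁺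
    expectedCost {k} A c = fromℕ k ⁻¹ *⁺ sum⁺ (λ s → Cost (output A c s) c)

    IsCompetitive : ∀ {k} → BarelyRandomAlgorithm k → ℝ → Set
    IsCompetitive A α =
      ∃ λ (β : ℝ) → ∀ c → NonNegative c → expectedCost A c ≤⁺ α *⁺ OPT c +⁺ [ β ]

{-# OPTIONS --safe #-}
module Submission where

open import Defs
open import Algebra.Bundles using (CommutativeRing)
open import Axiom.ExcludedMiddle using (ExcludedMiddle)
open import Data.Empty using (⊥-elim)
open import Data.Fin.Base using (Fin; zero; suc; toℕ; fromℕ<)
open import Data.Fin.Properties using (_≟_; suc-injective; toℕ-fromℕ; toℕ-inject₁)
open import Data.List.Base using (List; []; _∷_; allFin; applyUpTo; foldl)
open import Data.List.Membership.Propositional using (_∈_)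
open import Data.List.Membership.Propositional.Properties using (∈-allFin)
open import Data.List.Properties using (applyUpTo-∷ʳ; foldl-∷ʳ)
open import Data.List.Relation.Unary.Any using (here; there)
open import Data.Nat.Base using (ℕ; zero; suc; z≤n; s≤s; _∸_; _⊔_; _≤′_; ≤′-refl; ≤′-step) renaming (_≤_ to _≤ℕ_; _+_ to _+ℕ_)
open import Data.Nat.Properties using (m≤n⇒m≤1+n; m∸n+n≡m; n≤1+n; m≤m⊔n; m≤n⊔m; ≤⇒≤′) renaming (≤-trans to ≤ℕ-trans)
open import Data.Product.Base using (∃; _,_; proj₁; proj₂; _×_)
open import Data.Sum.Base using (_⊎_; inj₁; inj₂)
open import Data.Unit.Base using (⊤; tt)
open import Data.Vec.Functional using (updateAt)
open import Data.Vec.Functional.Properties using (updateAt-updates; updateAt-minimal)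
open import Function.Base using (_∘_; const; id)
open import Function.Bundles using (Inverse)
import Function.Metric.Structures as Metric
open import Level using (0ℓ)
open import Relation.Binary.Bundles using (Poset)
import Relation.Binary.Construct.Add.Supremum.NonStrict as AddSupremum
open import Relation.Binary.PropositionalEquality using (_≡_; _≢_; refl; sym; trans; cong; cong₂; subst)
open import Relation.Binary.Structures using (IsTotalOrder)
open import Relation.Nullary using (¬_; yes; no)
open import Relation.Nullary.Construct.Add.Supremum using ([_]; ⊤⁺)
open import Relation.Nullary.Decidable using (decidable-stable)
open import Relation.Unary using (Pred; Satisfiable)

-- Subtract from each cost vector its minimum, which everybody pays.  A phase lasts
-- until every state has accumulated excess 1; the offline player then has either
-- moved or paid 1 during the phase.  Online, seeds sit only on alive states (excess
-- below 1), and a seed whose state dies moves to a least loaded alive state, so that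
-- with m states alive no load exceeds n/m + 1.  Hence the m-th last state to die costs
-- at most n/m + 1 in service and n/m + 1 in movement, which sums to 2n(Hₙ + 1) over a
-- phase, plus 2n for moving all seeds twice when the phase changes.

-- Cost vectors are unbounded, so the vector that kills a state may carry an arbitrarily large
-- excess there. But a vector is seen before the state that pays it is chosen: seeds leave a dying
-- state first, so excess is paid only on states that survive the step, less than 1 in total on each
-- per phase. The vector that ends a phase leaves no survivor. All seeds then gather at its minimum,
-- where the excess is 0, and spread out again at the next step; hence two moves at each change of
-- phase.
--
-- An even spread over m alive states would have load n/m, but seeds are indivisible, and shifting
-- seeds off surviving states would cost movement. Leaving those in place and sending the others to
-- lightest states loses the additional 1 in the load bound.
--
-- Service is paid under the load bound of the current alive count, whereas a dying state is charged
-- under the bound at its death. Load bounds only grow as states die, so excess already paid can be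
-- repriced upwards. This turns the count over a whole phase into a potential inequality for a
-- single step, which also handles several simultaneous deaths.

-- Arithmetic in an ordered field

module OrderedFieldProperties (F : CompleteOrderedField) where
  open CompleteOrderedField F

  commutativeRing : CommutativeRing 0ℓ 0ℓ
  commutativeRing = record { isCommutativeRing = isCommutativeRing }

  open CommutativeRing commutativeRing public
    using (+-comm; +-assoc; +-identityˡ; +-identityʳ; -‿inverseʳ; *-comm; *-assoc;
           *-identityˡ; *-identityʳ; zeroˡ; zeroʳ; distribˡ; commutativeSemiring; semiring)
  open import Algebra.Properties.Semiring.Sum semiring public
    using (sum; sum-cong-≗; sum-replicate; sum-replicate-zero; sum-init-last;
           ∑-distrib-+; ∑-comm; *-distribˡ-sum; *-distribʳ-sum)
  open import Algebra.Properties.Semiring.Mult semiring public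
    using (×-homo-+)
  open import Algebra.Properties.Semiring.Mult.TCOptimised semiring public
    using (×ᵤ≈×)
  open import Algebra.Solver.Ring.NaturalCoefficients.Default commutativeSemiring public
    using (solve; con; _:+_; _:*_; _:=_)
  open IsTotalOrder isTotalOrder public
    using () renaming (refl to ≤-refl; trans to ≤-trans; antisym to ≤-antisym;
                       reflexive to ≤-reflexive; total to ≤-total)

  ≤-poset : Poset 0ℓ 0ℓ 0ℓ
  ≤-poset = record { isPartialOrder = IsTotalOrder.isPartialOrder isTotalOrder }

  open import Relation.Binary.Reasoning.PartialOrder ≤-poset public

  +-mono-≤ : ∀ {x y u v} → x ≤ y → u ≤ v → x + u ≤ y + v
  +-mono-≤ {x} {y} {u} {v} x≤y u≤v = begin
    x + u  ≤⟨ +-monoˡ-≤ u x≤y ⟩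
    y + u  ≡⟨ +-comm y u ⟩
    u + y  ≤⟨ +-monoˡ-≤ y u≤v ⟩
    v + y  ≡⟨ +-comm v y ⟩
    y + v  ∎

  +-cancelʳ : ∀ x z → (x + z) + - z ≡ x
  +-cancelʳ x z = trans (+-assoc x z (- z)) (trans (cong (x +_) (-‿inverseʳ z)) (+-identityʳ x))

  +-cancelʳ-≤ : ∀ {x y} z → x + z ≤ y + z → x ≤ y
  +-cancelʳ-≤ {x} {y} z p = begin
    x              ≡⟨ +-cancelʳ x z ⟨
    (x + z) + - z  ≤⟨ +-monoˡ-≤ (- z) p ⟩
    (y + z) + - z  ≡⟨ +-cancelʳ y z ⟩
    y              ∎

  -- Reduces a linear inequality to a semiring identity, the hypothesis being the
  -- sum of the inequalities from which it follows.
  ≤-by : ∀ {a b x y} → a ≤ b → x + b ≡ y + a → x ≤ y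
  ≤-by {a} {b} {x} {y} a≤b eq = +-cancelʳ-≤ a (begin
    x + a  ≤⟨ +-mono-≤ ≤-refl a≤b ⟩
    x + b  ≡⟨ eq ⟩
    y + a  ∎)

  +-nonNegative : ∀ {x y} → 0# ≤ x → 0# ≤ y → 0# ≤ x + y
  +-nonNegative {x} {y} 0≤x 0≤y = subst (_≤ x + y) (+-identityˡ 0#) (+-mono-≤ 0≤x 0≤y)

  x≤x+y : ∀ {x y} → 0# ≤ y → x ≤ x + y
  x≤x+y {x} {y} 0≤y = subst (_≤ x + y) (+-identityʳ x) (+-mono-≤ ≤-refl 0≤y)

  difference : ∀ x y → x + (y + - x) ≡ y
  difference x y = trans (cong (x +_) (+-comm y (- x)))
    (trans (sym (+-assoc x (- x) y)) (trans (cong (_+ y) (-‿inverseʳ x)) (+-identityˡ y)))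

  difference-nonNegative : ∀ {x y} → x ≤ y → 0# ≤ y + - x
  difference-nonNegative {x} {y} x≤y = ≤-by x≤y
    (trans (+-identityˡ y) (trans (sym (difference x y)) (+-comm x (y + - x))))

  +-≤⇒≤-difference : ∀ {x y z} → x + y ≤ z → y ≤ z + - x
  +-≤⇒≤-difference {x} {y} {z} p = ≤-by p (trans (+-comm y z)
    (trans (cong (_+ y) (trans (sym (difference x z)) (+-comm x _))) (+-assoc _ x y)))

  ≤-difference⇒+-≤ : ∀ {x y z} → y ≤ z + - x → x + y ≤ z
  ≤-difference⇒+-≤ {x} {y} {z} p = subst (x + y ≤_) (difference x z) (+-mono-≤ ≤-refl p)

  *-monoʳ-≤ : ∀ {x y z} → 0# ≤ z → x ≤ y → z * x ≤ z * y
  *-monoʳ-≤ {x} {y} {z} 0≤z x≤y = begin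
    z * x                    ≤⟨ x≤x+y (*-nonNegative 0≤z (difference-nonNegative x≤y)) ⟩
    z * x + z * (y + - x)    ≡⟨ distribˡ z x (y + - x) ⟨
    z * (x + (y + - x))      ≡⟨ cong (z *_) (difference x y) ⟩
    z * y                    ∎

  *-monoˡ-≤ : ∀ {x y z} → 0# ≤ z → x ≤ y → x * z ≤ y * z
  *-monoˡ-≤ {x} {y} {z} 0≤z x≤y = begin
    x * z  ≡⟨ *-comm x z ⟩
    z * x  ≤⟨ *-monoʳ-≤ 0≤z x≤y ⟩
    z * y  ≡⟨ *-comm z y ⟩
    y * z  ∎

  0≤1 : 0# ≤ 1#
  0≤1 with ≤-total 0# 1#
  ... | inj₁ p = p
  ... | inj₂ p = subst (0# ≤_) -1*-1≡1 (*-nonNegative 0≤-1 0≤-1)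
    where
    0≤-1 : 0# ≤ - 1#
    0≤-1 = subst (0# ≤_) (+-identityˡ (- 1#)) (difference-nonNegative p)
    open import Algebra.Properties.Ring (CommutativeRing.ring commutativeRing)
      using (-1*x≈-x; -‿involutive)
    -1*-1≡1 : - 1# * - 1# ≡ 1#
    -1*-1≡1 = trans (-1*x≈-x (- 1#)) (-‿involutive 1#)

  1≰0 : ¬ 1# ≤ 0#
  1≰0 p = 0≢1 (≤-antisym 0≤1 p)

  fromℕ-nonNegative : ∀ m → 0# ≤ fromℕ m
  fromℕ-nonNegative zero    = ≤-refl
  fromℕ-nonNegative (suc m) = +-nonNegative 0≤1 (fromℕ-nonNegative m)

  fromℕ-mono-≤ : ∀ {m k} → m ≤ℕ k → fromℕ m ≤ fromℕ k
  fromℕ-mono-≤ {k = k} z≤n = fromℕ-nonNegative k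
  fromℕ-mono-≤ (s≤s m≤k)   = +-mono-≤ ≤-refl (fromℕ-mono-≤ m≤k)

  fromℕ-suc≢0 : ∀ m → fromℕ (suc m) ≢ 0#
  fromℕ-suc≢0 m eq = 1≰0 (subst (1# ≤_) eq (x≤x+y (fromℕ-nonNegative m)))

  ⁻¹-nonNegative : ∀ {x} → 0# ≤ x → x ≢ 0# → 0# ≤ x ⁻¹
  ⁻¹-nonNegative {x} 0≤x x≢0 with ≤-total 0# (x ⁻¹)
  ... | inj₁ p = p
  ... | inj₂ p = ⊥-elim (1≰0 (begin
    1#        ≡⟨ *-inverseʳ x x≢0 ⟨
    x * x ⁻¹  ≤⟨ *-monoʳ-≤ 0≤x p ⟩
    x * 0#    ≡⟨ zeroʳ x ⟩
    0#        ∎))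

  ⁻¹-cancel : ∀ {x} → x ≢ 0# → ∀ y → x ⁻¹ * (x * y) ≡ y
  ⁻¹-cancel {x} x≢0 y = trans (sym (*-assoc (x ⁻¹) x y))
    (trans (cong (_* y) (trans (*-comm (x ⁻¹) x) (*-inverseʳ x x≢0))) (*-identityˡ y))

  ≤-divide : ∀ {x y z} → 0# ≤ x → x ≢ 0# → x * y ≤ z → y ≤ z * x ⁻¹
  ≤-divide {x} {y} {z} 0≤x x≢0 xy≤z = begin
    y               ≡⟨ ⁻¹-cancel x≢0 y ⟨
    x ⁻¹ * (x * y)  ≤⟨ *-monoʳ-≤ (⁻¹-nonNegative 0≤x x≢0) xy≤z ⟩
    x ⁻¹ * z        ≡⟨ *-comm (x ⁻¹) z ⟩
    z * x ⁻¹        ∎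

  ⁻¹-antitone : ∀ {x y} → 0# ≤ x → x ≢ 0# → y ≢ 0# → x ≤ y → y ⁻¹ ≤ x ⁻¹
  ⁻¹-antitone {x} {y} 0≤x x≢0 y≢0 x≤y = subst (y ⁻¹ ≤_) (*-identityˡ (x ⁻¹))
    (≤-divide 0≤x x≢0 (begin
      x * y ⁻¹  ≤⟨ *-monoˡ-≤ (⁻¹-nonNegative (≤-trans 0≤x x≤y) y≢0) x≤y ⟩
      y * y ⁻¹  ≡⟨ *-inverseʳ y y≢0 ⟩
      1#        ∎))

  sum-mono-≤ : ∀ {k} {f g : Fin k → ℝ} → (∀ i → f i ≤ g i) → sum f ≤ sum g
  sum-mono-≤ {zero}  f≤g = ≤-refl
  sum-mono-≤ {suc k} f≤g = +-mono-≤ (f≤g zero) (sum-mono-≤ (λ i → f≤g (suc i)))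

  sum-const : ∀ k x → sum {k} (λ _ → x) ≡ fromℕ k * x
  sum-const k x = begin-equality
    sum {k} (λ _ → x)         ≡⟨ sum-cong-≗ {k} (λ _ → *-identityˡ x) ⟨
    sum {k} (λ _ → 1# * x)    ≡⟨ *-distribʳ-sum {k} x (λ _ → 1#) ⟨
    sum {k} (λ _ → 1#) * x    ≡⟨ cong (_* x) (sum-replicate k) ⟩
    fromℕ k * x               ∎

  sum-nonNegative : ∀ {k} {f : Fin k → ℝ} → (∀ i → 0# ≤ f i) → 0# ≤ sum f
  sum-nonNegative {k} {f} 0≤f =
    subst (_≤ sum f) (sum-replicate-zero k) (sum-mono-≤ {k} 0≤f)

  H-suc : ∀ m → H (suc m) ≡ H m + fromℕ (suc m) ⁻¹
  H-suc m = trans (sum-init-last {m} (λ i → fromℕ (suc (toℕ i)) ⁻¹))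
    (cong₂ _+_ (sum-cong-≗ {m} (λ i → cong (λ j → fromℕ (suc j) ⁻¹) (toℕ-inject₁ i)))
               (cong (λ j → fromℕ (suc j) ⁻¹) (toℕ-fromℕ m)))

  H-nonNegative : ∀ m → 0# ≤ H m
  H-nonNegative m = sum-nonNegative {m}
    (λ i → ⁻¹-nonNegative (fromℕ-nonNegative (suc (toℕ i))) (fromℕ-suc≢0 (toℕ i)))

-- Indicators, counting, and loads of seed assignments

module Loads (em : ExcludedMiddle 0ℓ) (F : CompleteOrderedField) where
  open CompleteOrderedField F
  open OrderedFieldProperties F

  𝟙 : Set → ℝ
  𝟙 P with em {P}
  ... | yes _ = 1#
  ... | no  _ = 0#

  𝟙-true : ∀ {P} → P → 𝟙 P ≡ 1#
  𝟙-true {P} p with em {P}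
  ... | yes _ = refl
  ... | no ¬p = ⊥-elim (¬p p)

  𝟙-false : ∀ {P} → ¬ P → 𝟙 P ≡ 0#
  𝟙-false {P} ¬p with em {P}
  ... | yes p = ⊥-elim (¬p p)
  ... | no  _ = refl

  𝟙-nonNegative : ∀ P → 0# ≤ 𝟙 P
  𝟙-nonNegative P with em {P}
  ... | yes _ = 0≤1
  ... | no  _ = ≤-refl

  𝟙≤1 : ∀ P → 𝟙 P ≤ 1#
  𝟙≤1 P with em {P}
  ... | yes _ = ≤-refl
  ... | no  _ = 0≤1

  𝟙-mono : ∀ {P Q} → (P → Q) → 𝟙 P ≤ 𝟙 Q
  𝟙-mono {P} {Q} P⇒Q with em {P}
  ... | yes p = ≤-reflexive (sym (𝟙-true (P⇒Q p)))
  ... | no  _ = 𝟙-nonNegative Q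

  𝟙-cong : ∀ {P Q} → (P → Q) → (Q → P) → 𝟙 P ≡ 𝟙 Q
  𝟙-cong P⇒Q Q⇒P = ≤-antisym (𝟙-mono P⇒Q) (𝟙-mono Q⇒P)

  -- A natural number rather than a sum of indicators, because load bounds and budgets are indexed
  -- by it; `fromℕ-count` links the two.
  count : ∀ {k} → (Fin k → Set) → ℕ
  count {zero}  S = 0
  count {suc k} S with em {S zero}
  ... | yes _ = suc (count (S ∘ suc))
  ... | no  _ = count (S ∘ suc)

  fromℕ-count : ∀ {k} (S : Fin k → Set) → fromℕ (count S) ≡ sum (λ x → 𝟙 (S x))
  fromℕ-count {zero}  S = refl
  fromℕ-count {suc k} S with em {S zero}
  ... | yes _ = cong (1# +_) (fromℕ-count (S ∘ suc))
  ... | no  _ = trans (fromℕ-count (S ∘ suc)) (sym (+-identityˡ _))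

  count-mono : ∀ {k} {S S′ : Fin k → Set} → (∀ x → S x → S′ x) → count S ≤ℕ count S′
  count-mono {zero}  _ = z≤n
  count-mono {suc k} {S} {S′} S⊆S′ with em {S zero} | em {S′ zero}
  ... | yes _ | yes _ = s≤s (count-mono (S⊆S′ ∘ suc))
  ... | yes p | no ¬p = ⊥-elim (¬p (S⊆S′ zero p))
  ... | no _  | yes _ = m≤n⇒m≤1+n (count-mono (S⊆S′ ∘ suc))
  ... | no _  | no _  = count-mono (S⊆S′ ∘ suc)

  count≤ : ∀ {k} (S : Fin k → Set) → count S ≤ℕ k
  count≤ {zero}  S = z≤n
  count≤ {suc k} S with em {S zero}
  ... | yes _ = s≤s (count≤ (S ∘ suc))
  ... | no  _ = m≤n⇒m≤1+n (count≤ (S ∘ suc))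

  count-positive : ∀ {k} {S : Fin k → Set} {x} → S x → ∃ λ m → count S ≡ suc m
  count-positive {suc k} {S} {x} Sx with em {S zero}
  ... | yes _ = count (S ∘ suc) , refl
  count-positive {suc k} {S} {zero}  Sx | no ¬S0 = ⊥-elim (¬S0 Sx)
  count-positive {suc k} {S} {suc x} Sx | no _   = count-positive {k} {S ∘ suc} Sx

  sum-δ : ∀ {k} (i : Fin k) (h : Fin k → ℝ) → sum (λ j → 𝟙 (i ≡ j) * h j) ≡ h i
  sum-δ {suc k} zero h = begin-equality
    𝟙 (zero ≡ zero) * h zero + sum (λ j → 𝟙 (zero ≡ suc j) * h (suc j))
      ≡⟨ cong₂ _+_ (trans (cong (_* h zero) (𝟙-true refl)) (*-identityˡ _))
           (trans (sum-cong-≗ {k} (λ j → trans (cong (_* h (suc j)) (𝟙-false λ ())) (zeroˡ _)))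
                  (sum-replicate-zero k)) ⟩
    h zero + 0#
      ≡⟨ +-identityʳ _ ⟩
    h zero ∎
  sum-δ {suc k} (suc i) h = begin-equality
    𝟙 (suc i ≡ zero) * h zero + sum (λ j → 𝟙 (suc i ≡ suc j) * h (suc j))
      ≡⟨ cong₂ _+_ (trans (cong (_* h zero) (𝟙-false λ ())) (zeroˡ _))
           (sum-cong-≗ {k} (λ j → cong (_* h (suc j)) (𝟙-cong suc-injective (cong suc)))) ⟩
    0# + sum (λ j → 𝟙 (i ≡ j) * h (suc j))
      ≡⟨ +-identityˡ _ ⟩
    sum (λ j → 𝟙 (i ≡ j) * h (suc j))
      ≡⟨ sum-δ i (h ∘ suc) ⟩
    h (suc i) ∎

  load : ∀ {k n} → (Fin k → Fin n) → Fin n → ℝ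
  load g x = sum (λ s → 𝟙 (g s ≡ x))

  sum-load : ∀ {k n} (g : Fin k → Fin n) (h : Fin n → ℝ) →
             sum (λ s → h (g s)) ≡ sum (λ x → load g x * h x)
  sum-load {k} {n} g h = begin-equality
    sum (λ s → h (g s))                              ≡⟨ sum-cong-≗ {k} (λ s → sum-δ (g s) h) ⟨
    sum (λ s → sum (λ x → 𝟙 (g s ≡ x) * h x))        ≡⟨ ∑-comm {k} {n} (λ s x → 𝟙 (g s ≡ x) * h x) ⟩
    sum (λ x → sum (λ s → 𝟙 (g s ≡ x) * h x))
      ≡⟨ sum-cong-≗ {n} (λ x → *-distribʳ-sum {k} (h x) (λ s → 𝟙 (g s ≡ x))) ⟨
    sum (λ x → load g x * h x)                       ∎

  -- Multiplying the hypothesis by `h` restricts it to the support of `h`: load bounds are known on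
  -- alive states only.
  sum-load-≤ : ∀ {k n} (g : Fin k → Fin n) (h : Fin n → ℝ) {a} →
               (∀ x → load g x * h x ≤ a * h x) → sum (λ s → h (g s)) ≤ a * sum h
  sum-load-≤ {k} {n} g h {a} bound = begin
    sum (λ s → h (g s))         ≡⟨ sum-load g h ⟩
    sum (λ x → load g x * h x)  ≤⟨ sum-mono-≤ {n} bound ⟩
    sum (λ x → a * h x)         ≡⟨ *-distribˡ-sum {n} a h ⟨
    a * sum h                   ∎

  sum-δʳ : ∀ {k} (i : Fin k) → sum (λ j → 𝟙 (j ≡ i)) ≡ 1#
  sum-δʳ {k} i = trans
    (sum-cong-≗ {k} (λ j → trans (𝟙-cong sym sym) (sym (*-identityʳ _))))
    (sum-δ i (λ _ → 1#))

  sum-load-total : ∀ {k n} (g : Fin k → Fin n) → sum (load g) ≡ fromℕ k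
  sum-load-total {k} {n} g = begin-equality
    sum (load g)                 ≡⟨ sum-cong-≗ {n} (λ x → *-identityʳ (load g x)) ⟨
    sum (λ x → load g x * 1#)    ≡⟨ sum-load g (λ _ → 1#) ⟨
    sum {k} (λ _ → 1#)           ≡⟨ sum-replicate k ⟩
    fromℕ k                      ∎

  load-nonNegative : ∀ {k n} (g : Fin k → Fin n) x → 0# ≤ load g x
  load-nonNegative {k} g x = sum-nonNegative {k} (λ s → 𝟙-nonNegative (g s ≡ x))

  argmin : ∀ {k} (S : Fin k → Set) (f : Fin k → ℝ) → ∃ S →
           ∃ λ x → S x × (∀ y → S y → f x ≤ f y)
  argmin {suc k} S f (x₀ , Sx₀) with em {∃ (S ∘ suc)}
  argmin {suc k} S f (zero   , S0)  | no ∄ = zero , S0 , λ where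
    zero    _  → ≤-refl
    (suc y) Sy → ⊥-elim (∄ (y , Sy))
  argmin {suc k} S f (suc x₀ , Sx₀) | no ∄ = ⊥-elim (∄ (x₀ , Sx₀))
  argmin {suc k} S f _ | yes p with argmin (S ∘ suc) (f ∘ suc) p
  ... | x , Sx , least with ≤-total (f zero) (f (suc x)) | em {S zero}
  ...   | inj₁ f0≤fx | yes S0 = zero , S0 , λ where
    zero    _  → ≤-refl
    (suc y) Sy → ≤-trans f0≤fx (least y Sy)
  ...   | inj₂ fx≤f0 | _ = suc x , Sx , λ where
    zero    _  → fx≤f0
    (suc y) Sy → least y Sy
  ...   | inj₁ _ | no ¬S0 = suc x , Sx , λ where
    zero    S0 → ⊥-elim (¬S0 S0)
    (suc y) Sy → least y Sy

  -- Averaging: the minimum load on `S` times the size of `S` is at most the total load, which is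
  -- the number of seeds, wherever they sit.
  lightest : ∀ {k n} (g : Fin k → Fin n) (S : Fin n → Set) → ∃ S →
             ∃ λ x → S x × load g x ≤ fromℕ k * fromℕ (count S) ⁻¹
  lightest {k} {n} g S (x₀ , Sx₀) with argmin S (load g) (x₀ , Sx₀)
  ... | x , Sx , least = x , Sx ,
    ≤-divide (fromℕ-nonNegative (count S)) count≢0 (begin
      fromℕ (count S) * load g x          ≡⟨ cong (_* load g x) (fromℕ-count S) ⟩
      sum (λ y → 𝟙 (S y)) * load g x      ≡⟨ *-distribʳ-sum {n} (load g x) (λ y → 𝟙 (S y)) ⟩
      sum (λ y → 𝟙 (S y) * load g x)      ≤⟨ sum-mono-≤ {n} pointwise ⟩
      sum (load g)                        ≡⟨ sum-load-total g ⟩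
      fromℕ k                             ∎)
    where
    count≢0 : fromℕ (count S) ≢ 0#
    count≢0 with count-positive {S = S} Sx
    ... | m , eq = subst (λ c → fromℕ c ≢ 0#) (sym eq) (fromℕ-suc≢0 m)

    pointwise : ∀ y → 𝟙 (S y) * load g x ≤ load g y
    pointwise y with em {S y}
    ... | yes Sy = subst (_≤ load g y) (sym (*-identityˡ _)) (least y Sy)
    ... | no  _  = subst (_≤ load g y) (sym (zeroˡ _)) (load-nonNegative g y)

  load-updateAt-≢ : ∀ {k n} (g : Fin k → Fin n) s {x y} → x ≢ y →
                    load (updateAt g s (const x)) y ≤ load g y
  load-updateAt-≢ {k} g s {x} {y} x≢y = sum-mono-≤ {k} (λ r → 𝟙-mono (unchanged r))
    where
    unchanged : ∀ r → updateAt g s (const x) r ≡ y → g r ≡ y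
    unchanged r eq with r ≟ s
    ... | yes refl = ⊥-elim (x≢y (trans (sym (updateAt-updates s g)) eq))
    ... | no  r≢s  = trans (sym (updateAt-minimal r s g r≢s)) eq

  load-updateAt : ∀ {k n} (g : Fin k → Fin n) s x →
                  load (updateAt g s (const x)) x ≤ load g x + 1#
  load-updateAt {k} g s x = begin
    load (updateAt g s (const x)) x                  ≤⟨ sum-mono-≤ {k} pointwise ⟩
    sum (λ r → 𝟙 (g r ≡ x) + 𝟙 (r ≡ s))              ≡⟨ ∑-distrib-+ {k} _ _ ⟩
    load g x + sum (λ r → 𝟙 (r ≡ s))                 ≡⟨ cong (load g x +_) (sum-δʳ s) ⟩
    load g x + 1#                                    ∎
    where
    pointwise : ∀ r → 𝟙 (updateAt g s (const x) r ≡ x) ≤ 𝟙 (g r ≡ x) + 𝟙 (r ≡ s)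
    pointwise r with r ≟ s
    ... | yes r≡s = begin
      𝟙 (updateAt g s (const x) r ≡ x)  ≤⟨ 𝟙≤1 _ ⟩
      1#                                ≡⟨ +-identityˡ 1# ⟨
      0# + 1#                           ≤⟨ +-mono-≤ (𝟙-nonNegative _) (≤-reflexive (sym (𝟙-true r≡s))) ⟩
      𝟙 (g r ≡ x) + 𝟙 (r ≡ s)           ∎
    ... | no r≢s = ≤-trans
      (𝟙-mono (trans (sym (updateAt-minimal r s g r≢s)))) (x≤x+y (𝟙-nonNegative _))

  -- Seeds are treated one at a time. One found outside `S` goes to a lightest state of `S`, whose
  -- load just before is at most the average, hence at most the average plus one afterwards; no
  -- other load grows. Seeds already in `S` stay, so they cause no movement cost.
  rebalance : ∀ {k n} (S : Fin n → Set) → ∃ S → ∀ {a} →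
              fromℕ k * fromℕ (count S) ⁻¹ + 1# ≤ a →
              (g : Fin k → Fin n) → (∀ {x} → S x → load g x ≤ a) →
              ∃ λ (g′ : Fin k → Fin n) → (∀ s → S (g′ s)) ×
                (∀ {s} → S (g s) → g′ s ≡ g s) × (∀ {x} → S x → load g′ x ≤ a)
  rebalance {k} {n} S ∃S {a} average≤a g load≤a =
    let g′ , placed , kept , bound = go (allFin k)
    in g′ , (λ s → placed (∈-allFin s)) , kept , bound
    where
    go : (seeds : List (Fin k)) → ∃ λ (g′ : Fin k → Fin n) → (∀ {s} → s ∈ seeds → S (g′ s)) ×
           (∀ {s} → S (g s) → g′ s ≡ g s) × (∀ {x} → S x → load g′ x ≤ a)
    go [] = g , (λ ()) , (λ _ → refl) , load≤a
    go (s ∷ seeds) with go seeds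
    ... | g₁ , placed , kept , bound with em {S (g₁ s)}
    ...   | yes Sg₁s = g₁ , placed₁ , kept , bound
      where
      placed₁ : ∀ {r} → r ∈ s ∷ seeds → S (g₁ r)
      placed₁ (here refl) = Sg₁s
      placed₁ (there r∈)  = placed r∈
    ...   | no ¬Sg₁s with lightest g₁ S ∃S
    ...     | x , Sx , light = g₂ , placed₂ , kept₂ , bound₂
      where
      g₂ : Fin k → Fin n
      g₂ = updateAt g₁ s (const x)

      placed₂ : ∀ {r} → r ∈ s ∷ seeds → S (g₂ r)
      placed₂ (here refl) = subst S (sym (updateAt-updates s g₁)) Sx
      placed₂ {r} (there r∈) with r ≟ s
      ... | yes refl = subst S (sym (updateAt-updates s g₁)) Sx
      ... | no  r≢s  = subst S (sym (updateAt-minimal r s g₁ r≢s)) (placed r∈)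

      kept₂ : ∀ {r} → S (g r) → g₂ r ≡ g r
      kept₂ {r} Sgr with r ≟ s
      -- A seed that starts inside `S` has been kept by the recursive call, so it is not the one
      -- being moved.
      ... | yes refl = ⊥-elim (¬Sg₁s (subst S (sym (kept Sgr)) Sgr))
      ... | no  r≢s  = trans (updateAt-minimal r s g₁ r≢s) (kept Sgr)

      bound₂ : ∀ {y} → S y → load g₂ y ≤ a
      bound₂ {y} Sy with x ≟ y
      ... | no  x≢y  = ≤-trans (load-updateAt-≢ g₁ s x≢y) (bound Sy)
      ... | yes refl = begin
        load g₂ x                               ≤⟨ load-updateAt g₁ s x ⟩
        load g₁ x + 1#                          ≤⟨ +-mono-≤ light ≤-refl ⟩
        fromℕ k * fromℕ (count S) ⁻¹ + 1#       ≤⟨ average≤a ⟩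
        a                                       ∎

-- Load bounds and their harmonic sum

module Budget (F : CompleteOrderedField) (n : ℕ) where
  open CompleteOrderedField F
  open OrderedFieldProperties F

  -- The value at 0 is irrelevant, but this one keeps the function antitone.
  average : ℕ → ℝ
  average zero    = fromℕ n * fromℕ 1 ⁻¹
  average (suc m) = fromℕ n * fromℕ (suc m) ⁻¹

  loadBound : ℕ → ℝ
  loadBound m = average m + 1#

  budget : ℕ → ℝ
  budget zero    = 0#
  budget (suc m) = budget m + loadBound (suc m)

  budget≡ : ∀ m → budget m ≡ fromℕ n * H m + fromℕ m
  budget≡ zero    = sym (trans (+-identityʳ _) (zeroʳ (fromℕ n)))
  budget≡ (suc m) = begin-equality
    budget m + (fromℕ n * fromℕ (suc m) ⁻¹ + 1#)
      ≡⟨ cong (_+ (fromℕ n * fromℕ (suc m) ⁻¹ + 1#)) (budget≡ m) ⟩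
    fromℕ n * H m + fromℕ m + (fromℕ n * fromℕ (suc m) ⁻¹ + 1#)
      ≡⟨ solve 5 (λ k h j i o → k :* h :+ j :+ (k :* i :+ o) := k :* (h :+ i) :+ (o :+ j)) refl
           (fromℕ n) (H m) (fromℕ m) (fromℕ (suc m) ⁻¹) 1# ⟩
    fromℕ n * (H m + fromℕ (suc m) ⁻¹) + (1# + fromℕ m)
      ≡⟨ cong (λ h → fromℕ n * h + (1# + fromℕ m)) (H-suc m) ⟨
    fromℕ n * H (suc m) + fromℕ (suc m) ∎

  average-nonNegative : ∀ m → 0# ≤ average m
  average-nonNegative zero    = average-nonNegative 1
  average-nonNegative (suc m) = *-nonNegative (fromℕ-nonNegative n)
    (⁻¹-nonNegative (fromℕ-nonNegative (suc m)) (fromℕ-suc≢0 m))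

  1≤loadBound : ∀ m → 1# ≤ loadBound m
  1≤loadBound m = ≤-trans (x≤x+y (average-nonNegative m)) (≤-reflexive (+-comm _ _))

  loadBound-nonNegative : ∀ m → 0# ≤ loadBound m
  loadBound-nonNegative m = ≤-trans 0≤1 (1≤loadBound m)

  loadBound-suc : ∀ m → loadBound (suc m) ≤ loadBound m
  loadBound-suc zero    = ≤-refl
  loadBound-suc (suc m) = +-monoˡ-≤ 1# (*-monoʳ-≤ (fromℕ-nonNegative n)
    (⁻¹-antitone (fromℕ-nonNegative (suc m)) (fromℕ-suc≢0 m) (fromℕ-suc≢0 (suc m))
      (fromℕ-mono-≤ (n≤1+n (suc m)))))

  loadBound-+ : ∀ k m → loadBound (k +ℕ m) ≤ loadBound m
  loadBound-+ zero    m = ≤-refl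
  loadBound-+ (suc k) m = ≤-trans (loadBound-suc (k +ℕ m)) (loadBound-+ k m)

  loadBound-antitone : ∀ {m k} → m ≤ℕ k → loadBound k ≤ loadBound m
  loadBound-antitone {m} {k} m≤k =
    subst (λ j → loadBound j ≤ loadBound m) (m∸n+n≡m m≤k) (loadBound-+ (k ∸ m) m)

  -- Between `m` and `k +ℕ m` the budget collects `k` load bounds, of which the last is the
  -- smallest. So `k` simultaneous deaths, all priced at the count before the step, stay within the
  -- budget.
  budget-+ : ∀ k m → budget m + loadBound (k +ℕ m) * fromℕ k ≤ budget (k +ℕ m)
  budget-+ zero    m = ≤-reflexive (trans (cong (budget m +_) (zeroʳ _)) (+-identityʳ _))
  budget-+ (suc k) m = begin
    budget m + b′ * (1# + fromℕ k)
      ≡⟨ solve 4 (λ c a o j → c :+ a :* (o :+ j) := (c :+ a :* j) :+ a :* o) refl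
           (budget m) b′ 1# (fromℕ k) ⟩
    budget m + b′ * fromℕ k + b′ * 1#
      ≤⟨ +-mono-≤ (+-mono-≤ ≤-refl (*-monoˡ-≤ (fromℕ-nonNegative k) (loadBound-suc (k +ℕ m))))
           (≤-reflexive (*-identityʳ b′)) ⟩
    budget m + loadBound (k +ℕ m) * fromℕ k + b′
      ≤⟨ +-monoˡ-≤ b′ (budget-+ k m) ⟩
    budget (k +ℕ m) + b′ ∎
    where b′ = loadBound (suc (k +ℕ m))

  -- Deaths are counted by a sum of indicators, so the gap enters as a real `δ`, which the equation
  -- forces to be `k ∸ m`.
  budget-gap : ∀ {m k δ} → m ≤ℕ k → δ + fromℕ m ≡ fromℕ k →
               budget m + loadBound k * δ ≤ budget k
  budget-gap {m} {k} {δ} m≤k eq with k ∸ m | m∸n+n≡m m≤k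
  ... | j | refl = subst (λ x → budget m + loadBound (j +ℕ m) * x ≤ budget (j +ℕ m)) (sym δ≡j) (budget-+ j m)
    where
    δ≡j : δ ≡ fromℕ j
    δ≡j = trans (sym (+-cancelʳ δ (fromℕ m)))
      (trans (cong (_+ - fromℕ m) (trans eq (×-homo-+ 1# j m))) (+-cancelʳ (fromℕ j) (fromℕ m)))

  budget-mono : ∀ {m k} → m ≤ℕ k → budget m ≤ budget k
  budget-mono {m} {k} m≤k = ≤-trans
    (x≤x+y (*-nonNegative (loadBound-nonNegative k) (difference-nonNegative (fromℕ-mono-≤ m≤k))))
    (budget-gap m≤k (trans (+-comm _ _) (difference (fromℕ m) (fromℕ k))))

-- Weights that saturate at 1 and the potential inequality for one step

module Saturation (em : ExcludedMiddle 0ℓ) (F : CompleteOrderedField) (n : ℕ) where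
  open CompleteOrderedField F
  open OrderedFieldProperties F
  open Loads em F
  open Budget F n

  Weight : Set
  Weight = Fin n → ℝ

  Alive : Weight → Fin n → Set
  Alive w x = ¬ 1# ≤ w x

  alive : Weight → ℕ
  alive w = count (Alive w)

  aliveSum : Weight → (Fin n → ℝ) → ℝ
  aliveSum w h = sum (λ x → 𝟙 (Alive w x) * h x)

  alive⇒≤1 : ∀ {w x} → Alive w x → w x ≤ 1#
  alive⇒≤1 {w} {x} a with ≤-total (w x) 1#
  ... | inj₁ p = p
  ... | inj₂ p = ⊥-elim (a p)

  aliveSum-nonNegative : ∀ w {h} → (∀ x → 0# ≤ h x) → 0# ≤ aliveSum w h
  aliveSum-nonNegative w h≥0 =
    sum-nonNegative {n} (λ x → *-nonNegative (𝟙-nonNegative _) (h≥0 x))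

  𝟙-alive-≤ : ∀ w x → 𝟙 (Alive w x) * w x ≤ 𝟙 (Alive w x)
  𝟙-alive-≤ w x with em {Alive w x}
  ... | yes a = subst (_≤ 1#) (sym (*-identityˡ _)) (alive⇒≤1 {w} a)
  ... | no  _ = ≤-reflexive (zeroˡ _)

  aliveSum≤alive : ∀ w → aliveSum w w ≤ fromℕ (alive w)
  aliveSum≤alive w = ≤-trans (sum-mono-≤ {n} (𝟙-alive-≤ w)) (≤-reflexive (sym (fromℕ-count (Alive w))))

  -- Alive weights are at most 1, and the last bound in the budget is its smallest. Thus one budget
  -- covers the service charged so far on states still alive.
  loadBound*aliveSum≤budget : ∀ w → loadBound (alive w) * aliveSum w w ≤ budget (alive w)
  loadBound*aliveSum≤budget w = begin
    loadBound m * aliveSum w w        ≤⟨ *-monoʳ-≤ (loadBound-nonNegative m) (aliveSum≤alive w) ⟩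
    loadBound m * fromℕ m             ≡⟨ +-identityˡ _ ⟨
    0# + loadBound m * fromℕ m        ≤⟨ budget-gap {k = m} z≤n (+-identityʳ _) ⟩
    budget m                          ∎
    where m = alive w

  module Increase (w e w′ : Weight) (w≥0 : ∀ x → 0# ≤ w x) (e≥0 : ∀ x → 0# ≤ e x)
    (w′≡ : ∀ x → w′ x ≡ w x + e x) where

    survive : ∀ x → Alive w′ x → Alive w x
    survive x a p = a (subst (1# ≤_) (sym (w′≡ x)) (≤-trans p (x≤x+y (e≥0 x))))

    fewer : alive w′ ≤ℕ alive w
    fewer = count-mono survive

    dying : Fin n → ℝ
    dying x = 𝟙 (Alive w x × ¬ Alive w′ x)

    dying-alive : ∀ x → dying x + 𝟙 (Alive w′ x) ≡ 𝟙 (Alive w x)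
    dying-alive x with em {Alive w′ x}
    ... | yes a = trans (cong (_+ 1#) (𝟙-false (λ p → proj₂ p a)))
                    (trans (+-identityˡ 1#) (sym (𝟙-true (survive x a))))
    ... | no ¬a = trans (+-identityʳ _) (𝟙-cong proj₁ (_, ¬a))

    deaths : ℝ
    deaths = sum dying

    deaths+alive : deaths + fromℕ (alive w′) ≡ fromℕ (alive w)
    deaths+alive = begin-equality
      deaths + fromℕ (alive w′)                     ≡⟨ cong (deaths +_) (fromℕ-count (Alive w′)) ⟩
      deaths + sum (λ x → 𝟙 (Alive w′ x))           ≡⟨ ∑-distrib-+ {n} dying _ ⟨
      sum (λ x → dying x + 𝟙 (Alive w′ x))          ≡⟨ sum-cong-≗ {n} dying-alive ⟩
      sum (λ x → 𝟙 (Alive w x))                     ≡⟨ fromℕ-count (Alive w) ⟨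
      fromℕ (alive w)                               ∎

    -- A state that dies had weight at most 1 before the step, however large its excess in it, so
    -- each death removes at most 1 from the sum.
    aliveSum-shrink : aliveSum w w ≤ aliveSum w′ w + deaths
    aliveSum-shrink = ≤-trans (sum-mono-≤ {n} pointwise) (≤-reflexive (∑-distrib-+ {n} _ dying))
      where
      pointwise : ∀ x → 𝟙 (Alive w x) * w x ≤ 𝟙 (Alive w′ x) * w x + dying x
      pointwise x with em {Alive w′ x}
      ... | yes a = ≤-trans (≤-reflexive (cong (_* w x) (𝟙-true (survive x a)))) (x≤x+y (𝟙-nonNegative _))
      ... | no ¬a = begin
        𝟙 (Alive w x) * w x                        ≤⟨ 𝟙-alive-≤ w x ⟩
        𝟙 (Alive w x)                              ≤⟨ 𝟙-mono (_, ¬a) ⟩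
        𝟙 (Alive w x × ¬ Alive w′ x)               ≡⟨ +-identityˡ _ ⟨
        0# + 𝟙 (Alive w x × ¬ Alive w′ x)          ≡⟨ cong (_+ 𝟙 (Alive w x × ¬ Alive w′ x)) (zeroˡ (w x)) ⟨
        0# * w x + 𝟙 (Alive w x × ¬ Alive w′ x)    ∎

    aliveSum-increase : aliveSum w′ w′ ≡ aliveSum w′ w + aliveSum w′ e
    aliveSum-increase = trans
      (sum-cong-≗ {n} (λ x → trans (cong (𝟙 (Alive w′ x) *_) (w′≡ x)) (distribˡ _ (w x) (e x))))
      (∑-distrib-+ {n} _ _)

    -- The budget drops by at least `loadBound (alive w) * deaths`, and it occurs twice: one drop
    -- pays for moving seeds off the dying states, the other for the service done there earlier. The
    -- survivors' old weight is repriced at the new, larger load bound, at which their new excess is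
    -- charged too.
    budget-step :
      budget (alive w′) + budget (alive w′) + loadBound (alive w) * aliveSum w w +
        (loadBound (alive w) * deaths + loadBound (alive w′) * aliveSum w′ e)
      ≤ budget (alive w) + budget (alive w) + loadBound (alive w′) * aliveSum w′ w′
    budget-step = begin
      b′ + b′ + a * aliveSum w w + (a * deaths + a′ * aliveSum w′ e)
        ≤⟨ +-monoˡ-≤ _ (+-mono-≤ ≤-refl (*-monoʳ-≤ (loadBound-nonNegative (alive w)) aliveSum-shrink)) ⟩
      b′ + b′ + a * (aliveSum w′ w + deaths) + (a * deaths + a′ * aliveSum w′ e)
        ≡⟨ solve 6 (λ b a a′ x y z → b :+ b :+ a :* (x :+ y) :+ (a :* y :+ a′ :* z) :=
                     (b :+ a :* y) :+ (b :+ a :* y) :+ (a :* x :+ a′ :* z)) refl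
             b′ a a′ (aliveSum w′ w) deaths (aliveSum w′ e) ⟩
      (b′ + a * deaths) + (b′ + a * deaths) + (a * aliveSum w′ w + a′ * aliveSum w′ e)
        ≤⟨ +-mono-≤ (+-mono-≤ gap gap) (+-monoˡ-≤ _ (*-monoˡ-≤ weight≥0 (loadBound-antitone fewer))) ⟩
      b + b + (a′ * aliveSum w′ w + a′ * aliveSum w′ e)
        ≡⟨ cong (b + b +_) (trans (sym (distribˡ a′ _ _)) (cong (a′ *_) (sym aliveSum-increase))) ⟩
      b + b + a′ * aliveSum w′ w′ ∎
      where
      a  = loadBound (alive w)
      a′ = loadBound (alive w′)
      b  = budget (alive w)
      b′ = budget (alive w′)
      gap : b′ + a * deaths ≤ b
      gap = budget-gap fewer deaths+alive
      weight≥0 : 0# ≤ aliveSum w′ w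
      weight≥0 = aliveSum-nonNegative w′ w≥0

-- The algorithm and its offline lower bound

module Algorithm (em : ExcludedMiddle 0ℓ) (F : CompleteOrderedField) (n : ℕ) (x₀ : Fin n) where
  open CompleteOrderedField F
  open OrderedFieldProperties F
  open Loads em F
  open Budget F n
  open Saturation em F n

  Assignment : Set
  Assignment = Fin n → Fin n

  -- The plan is the balanced assignment of seeds to alive states.  It agrees with
  -- the actual position except right after a phase has ended, when every seed sits
  -- at the cheapest state.  The field lower is a bound on the offline cost so far;
  -- the algorithm itself does not consult it.
  record State : Set where
    field
      weight     : Weight
      weight≥0   : ∀ x → 0# ≤ weight x
      plan       : Assignment
      plan-alive : ∀ s → Alive weight (plan s)
      plan-load  : ∀ {x} → Alive weight x → load plan x ≤ loadBound (alive weight)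
      position   : Assignment
      lower      : ℝ

  open State

  fresh : Assignment → ℝ → State
  fresh p l = record
    { weight     = λ _ → 0#
    ; weight≥0   = λ _ → ≤-refl
    -- With as many seeds as states, the identity puts load 1 everywhere, and `loadBound` is at
    -- least 1 at every count.
    ; plan       = id
    ; plan-alive = λ _ → 1≰0
    ; plan-load  = λ {x} _ → ≤-trans (≤-reflexive (sum-δʳ x)) (1≤loadBound (alive (λ _ → 0#)))
    ; position   = p
    ; lower      = l
    }

  record Offset (v : Fin n → ℝ) : Set where
    field
      cheapest : Fin n
      excess   : Fin n → ℝ
      excess≥0 : ∀ x → 0# ≤ excess x
      v≡       : ∀ x → v x ≡ v cheapest + excess x

  offset : ∀ v → Offset v
  offset v with argmin (λ _ → ⊤) v (x₀ , tt)
  ... | z , _ , least = record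
    { cheapest = z
    ; excess   = λ x → v x + - v z
    ; excess≥0 = λ x → difference-nonNegative (least x tt)
    ; v≡       = λ x → sym (difference (v z) (v x))
    }

  module _ (S : State) {v : Fin n → ℝ} (o : Offset v) where
    open Offset o

    raised : Weight
    raised x = weight S x + excess x

    raised≥0 : ∀ x → 0# ≤ raised x
    raised≥0 x = +-nonNegative (weight≥0 S x) (excess≥0 x)

    -- A relation, because `step` branches on excluded middle and on the result of `rebalance`: both
    -- cost analyses match on the two constructors and see only the facts recorded in them.
    data Step : State → Set where
      continue : ∀ {g} (g-alive : ∀ s → Alive raised (g s))
        (g-load : ∀ {x} → Alive raised x → load g x ≤ loadBound (alive raised)) →
        (∀ {s} → Alive raised (plan S s) → g s ≡ plan S s) →
        Step record
          { weight     = raised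
          ; weight≥0   = raised≥0
          ; plan       = g
          ; plan-alive = g-alive
          ; plan-load  = g-load
          ; position   = g
          ; lower      = lower S + v cheapest
          }
      restart : (∀ x → 1# ≤ raised x) →
        Step (fresh (const cheapest) (lower S + v cheapest + 1#))

    step : ∃ Step
    step with em {∃ (Alive raised)}
    ... | no ∄ = _ , restart (λ x → decidable-stable em (λ ¬p → ∄ (x , ¬p)))
    ... | yes (x , a)
        with count-positive {S = Alive raised} a
           | rebalance (Alive raised) (x , a) {loadBound (alive raised)}
    ...   | m , eq | reb
          -- `loadBound` unfolds to this quotient only at a successor, which `count-positive`
          -- provides. The old plan respects the new bound because the bound grows as states die.
          with reb (≤-reflexive (trans (cong (λ j → fromℕ n * fromℕ j ⁻¹ + 1#) eq)
                                       (cong loadBound (sym eq))))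
                   (plan S)
                   (λ a′ → ≤-trans (plan-load S (survive _ a′)) (loadBound-antitone fewer))
      where open Increase (weight S) excess raised (weight≥0 S) excess≥0 (λ _ → refl)
    ...     | g , g-alive , kept , g-load = _ , continue g-alive g-load kept

  advance : State → (Fin n → ℝ) → State
  advance S v = proj₁ (step S (offset v))

  -- A lower bound on the work function: an offline schedule now at `x` has paid `lower S` plus the
  -- smaller of 1 and the weight of `x`. The cap 1 is the price of a move.
  OfflineBound : State → Fin n → ℝ → Set
  OfflineBound S x p = (lower S + 1# ≤ p) ⊎ (lower S + weight S x ≤ p)

  lower≤ : ∀ S {x p} → OfflineBound S x p → lower S ≤ p
  lower≤ S     (inj₁ p) = ≤-trans (x≤x+y 0≤1) p
  lower≤ S {x} (inj₂ p) = ≤-trans (x≤x+y (weight≥0 S x)) p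

  -- A unit once paid in the phase stays paid; a schedule that stays put accumulates the excess of
  -- its state; one that moves pays the unit. When the phase ends all weights have reached 1, so
  -- either alternative yields the unit added to `lower`.
  offline-step : ∀ {S v} {o : Offset v} {S′} → Step S o S′ →
                 ∀ {x y p δ} → OfflineBound S x p → 0# ≤ δ → x ≡ y ⊎ δ ≡ 1# →
                 OfflineBound S′ y (p + (δ + v y))
  offline-step {S} {v} {o} st {x} {y} {p} {δ} bound 0≤δ moved = conclude st
    where
    open Offset o
    L = lower S
    μ = v cheapest
    e = excess y

    raise : ∀ {δ′ r t} → δ′ ≡ r → L + t ≤ p → L + μ + (t + (r + e)) ≤ p + (δ′ + v y)
    raise {r = r} {t = t} refl L+t≤p = begin
      L + μ + (t + (r + e))
        ≡⟨ solve 5 (λ l u t r e → l :+ u :+ (t :+ (r :+ e)) := (l :+ t) :+ (r :+ (u :+ e))) refl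
             L μ t r e ⟩
      L + t + (r + (μ + e))    ≤⟨ +-monoˡ-≤ _ L+t≤p ⟩
      p + (r + (μ + e))        ≡⟨ cong (λ c → p + (r + c)) (v≡ y) ⟨
      p + (r + v y)            ∎

    paid : OfflineBound S x p → x ≡ y ⊎ δ ≡ 1# →
           (L + μ + 1# ≤ p + (δ + v y)) ⊎ (L + μ + raised S o y ≤ p + (δ + v y))
    paid (inj₁ L+1≤p) _ = inj₁ (≤-trans
      (+-mono-≤ ≤-refl (x≤x+y (+-nonNegative 0≤δ (excess≥0 y)))) (raise refl L+1≤p))
    paid (inj₂ L+w≤p) (inj₁ x≡y) = inj₂ (≤-trans
      (+-mono-≤ ≤-refl (+-mono-≤ ≤-refl (≤-trans (x≤x+y 0≤δ) (≤-reflexive (+-comm _ _)))))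
      (raise refl (subst (λ i → L + weight S i ≤ p) x≡y L+w≤p)))
    paid (inj₂ L+w≤p) (inj₂ δ≡1) = inj₁ (≤-trans
      (+-mono-≤ ≤-refl (≤-trans (x≤x+y (+-nonNegative (excess≥0 y) (weight≥0 S x)))
        (≤-reflexive (trans (sym (+-assoc _ _ _)) (+-comm _ _)))))
      (raise δ≡1 L+w≤p))

    conclude : ∀ {S′} → Step S o S′ → OfflineBound S′ y (p + (δ + v y))
    conclude (continue _ _ _) = paid bound moved
    conclude (restart dead) with paid bound moved
    ... | inj₁ q = inj₂ (≤-trans (≤-reflexive (+-identityʳ _)) q)
    ... | inj₂ q = inj₂ (≤-trans (≤-reflexive (+-identityʳ _)) (≤-trans (+-mono-≤ ≤-refl (dead y)) q))

  α : ℝ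
  α = fromℕ 2 * H n + fromℕ 6

  1≤α : 1# ≤ α
  1≤α = begin
    1#                   ≤⟨ x≤x+y (fromℕ-nonNegative 5) ⟩
    fromℕ 6              ≤⟨ x≤x+y (*-nonNegative (fromℕ-nonNegative 2) (H-nonNegative n)) ⟩
    fromℕ 6 + fromℕ 2 * H n  ≡⟨ +-comm _ _ ⟩
    α                    ∎

  0≤α : 0# ≤ α
  0≤α = ≤-trans 0≤1 1≤α

  N : ℝ
  N = fromℕ n

  N*≤N*α* : ∀ {x} → 0# ≤ x → N * x ≤ N * (α * x)
  N*≤N*α* {x} 0≤x = *-monoʳ-≤ (fromℕ-nonNegative n)
    (≤-trans (≤-reflexive (sym (*-identityˡ x))) (*-monoˡ-≤ 0≤x 1≤α))

  -- A phase costs a seed at most one unit of movement to reach the cheapest state,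
  -- one to reach the next plan, and its share of twice the budget.
  phase≤α : (N + N) + (budget n + budget n) ≤ N * α
  phase≤α = begin
    (N + N) + (budget n + budget n)
      ≡⟨ cong (λ b → (N + N) + (b + b)) (budget≡ n) ⟩
    (N + N) + ((N * H n + N) + (N * H n + N))
      -- The left side equals `N * (2 H n + 4)`; the added `N + N` is slack in the constant 6.
      ≤⟨ x≤x+y (+-nonNegative (fromℕ-nonNegative n) (fromℕ-nonNegative n)) ⟩
    (N + N) + ((N * H n + N) + (N * H n + N)) + (N + N)
      ≡⟨ solve 2 (λ k h → (k :+ k) :+ ((k :* h :+ k) :+ (k :* h :+ k)) :+ (k :+ k) :=
                   k :* (con 2 :* h :+ con 6)) refl N (H n) ⟩
    N * ((1# + 1#) * H n + (1# + 1# + 1# + 1# + 1# + 1#))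
      ≡⟨ cong₂ (λ a b → N * (a * H n + b)) (×ᵤ≈× 2 1#) (×ᵤ≈× 6 1#) ⟨
    N * α ∎

  -- Amortised cost of the online algorithm

  module Accounting (dist : Fin n → Fin n → ℝ)
    (dist-refl : ∀ x → dist x x ≡ 0#) (dist≥0 : ∀ x y → 0# ≤ dist x y)
    (dist≤1 : ∀ x y → dist x y ≤ 1#)
    (dist-triangle : ∀ x y z → dist x z ≤ dist x y + dist y z) where

    w₀ : Weight
    w₀ _ = 0#

    b₀ : ℝ
    b₀ = budget (alive w₀)

    b₀≤ : b₀ ≤ budget n
    b₀≤ = budget-mono (count≤ (Alive w₀))

    detour : State → ℝ
    detour S = sum (λ s → dist (position S s) (plan S s))

    stepCost : Assignment → Assignment → (Fin n → ℝ) → ℝ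
    stepCost f g v = sum (λ s → dist (f s) (g s) + v (g s))

    sum-dist≤N : ∀ (f g : Assignment) → sum (λ s → dist (f s) (g s)) ≤ N
    sum-dist≤N f g = ≤-trans (sum-mono-≤ {n} (λ s → dist≤1 (f s) (g s))) (≤-reflexive (sum-replicate n))

    sum-dist-refl : ∀ (g : Assignment) → sum (λ s → dist (g s) (g s)) ≡ 0#
    sum-dist-refl g = trans (sum-cong-≗ {n} (λ s → dist-refl (g s))) (sum-replicate-zero n)

    stepCost-split : ∀ {v} (o : Offset v) f g → let open Offset o in
      stepCost f g v ≡ sum (λ s → dist (f s) (g s)) + (N * v cheapest + sum (λ s → excess (g s)))
    stepCost-split {v} o f g = trans (∑-distrib-+ {n} _ _) (cong (sum (λ s → dist (f s) (g s)) +_)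
      (trans (sum-cong-≗ {n} (λ s → v≡ (g s))) (trans (∑-distrib-+ {n} _ _)
        (cong (_+ sum (λ s → excess (g s))) (sum-const n (v cheapest))))))
      where open Offset o

    allowance : State → ℝ
    allowance S = budget n + budget n + N * (α * lower S)

    -- A potential invariant for the total cost `p` of all seeds. On the left stand the movement
    -- still owed to reach the plan and two unspent budgets, for movement and for service. The last
    -- term on the right is service on states still alive, which is settled from a budget only when
    -- they die.
    OnlineBound : State → ℝ → Set
    OnlineBound S p = p + detour S + (budget (alive (weight S)) + budget (alive (weight S)))
      ≤ allowance S + loadBound (alive (weight S)) * aliveSum (weight S) (weight S)

    online≤ : ∀ S {p} → OnlineBound S p → p ≤ allowance S
    -- One remaining budget absorbs the unsettled service; the other, like the detour, is
    -- nonnegative and dropped.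
    online≤ S {p} bound = ≤-by
      (+-mono-≤ (+-mono-≤ bound (loadBound*aliveSum≤budget (weight S)))
                (+-mono-≤ (sum-nonNegative {n} (λ s → dist≥0 _ _)) budget≥0))
      (solve 5 (λ p k a d b → p :+ ((k :+ a :+ b) :+ (d :+ b)) :=
                 k :+ ((p :+ d :+ (b :+ b) :+ a) :+ (con 0 :+ con 0))) refl
        p (allowance S) (loadBound m * aliveSum (weight S) (weight S)) (detour S) (budget m))
      where
      m = alive (weight S)
      budget≥0 : 0# ≤ budget m
      budget≥0 = budget-mono {0} {m} z≤n

    online-start : OnlineBound (fresh id 0#) 0#
    online-start = begin
      0# + sum (λ s → dist s s) + (b₀ + b₀)
        ≡⟨ cong (_+ (b₀ + b₀)) (trans (+-identityˡ _) (sum-dist-refl id)) ⟩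
      0# + (b₀ + b₀)
        ≡⟨ +-identityˡ _ ⟩
      b₀ + b₀
        ≤⟨ +-mono-≤ b₀≤ b₀≤ ⟩
      budget n + budget n
        ≤⟨ x≤x+y (*-nonNegative (fromℕ-nonNegative n) (*-nonNegative 0≤α ≤-refl)) ⟩
      allowance (fresh id 0#)
        ≤⟨ x≤x+y (*-nonNegative (loadBound-nonNegative (alive w₀)) (aliveSum-nonNegative w₀ (λ _ → ≤-refl))) ⟩
      allowance (fresh id 0#) + loadBound (alive w₀) * aliveSum w₀ w₀ ∎

    online-step : ∀ {S v} {o : Offset v} {S′} → Step S o S′ → (∀ x → 0# ≤ v x) →
                  ∀ {p} → OnlineBound S p →
                  OnlineBound S′ (p + stepCost (position S) (position S′) v)
    online-step {S} {v} {o} (continue {g} g-alive g-load kept) v≥0 {p} bound = begin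
      p + stepCost (position S) g v + sum (λ s → dist (g s) (g s)) + (b′ + b′)
        ≡⟨ cong₂ (λ c t → p + c + t + (b′ + b′)) (stepCost-split o (position S) g) (sum-dist-refl g) ⟩
      p + (movement + (N * μ + extra)) + 0# + (b′ + b′)
        ≤⟨ ≤-by (+-mono-≤ (+-mono-≤ bound moves) (+-mono-≤ service (+-mono-≤ budget-step Nμ≤)))
             (solve 13 (λ p m u e b b′ d k x x′ y z t →
               (p :+ (m :+ (u :+ e)) :+ con 0 :+ (b′ :+ b′)) :+
                 (((k :+ x) :+ (d :+ y)) :+ (z :+ ((b :+ b :+ x′) :+ t))) :=
               ((k :+ t) :+ x′) :+
                 (((p :+ d :+ (b :+ b)) :+ m) :+ (e :+ ((b′ :+ b′ :+ x :+ (y :+ z)) :+ u)))) refl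
               p movement (N * μ) extra (budget (alive w)) b′ (detour S) (allowance S)
               (a * aliveSum w w) (a′ * aliveSum w′ w′) (a * deaths) (a′ * aliveSum w′ excess)
               (N * (α * μ))) ⟩
      allowance S + N * (α * μ) + a′ * aliveSum w′ w′
        ≡⟨ cong (_+ a′ * aliveSum w′ w′) (solve 5 (λ b k h l u →
             (b :+ k :* (h :* l)) :+ k :* (h :* u) := b :+ k :* (h :* (l :+ u))) refl
             (budget n + budget n) N α (lower S) μ) ⟩
      budget n + budget n + N * (α * (lower S + μ)) + a′ * aliveSum w′ w′ ∎
      where
      open Offset o
      w = weight S
      w′ = raised S o
      open Increase w excess w′ (weight≥0 S) excess≥0 (λ _ → refl)
      μ = v cheapest
      a = loadBound (alive w)
      a′ = loadBound (alive w′)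
      b′ = budget (alive w′)
      movement = sum (λ s → dist (position S s) (g s))
      extra = sum (λ s → excess (g s))

      moved : ∀ s → dist (plan S s) (g s) ≤ dying (plan S s)
      moved s with em {Alive w′ (plan S s)}
      ... | yes q = ≤-trans (≤-reflexive (trans (cong (dist _) (kept q)) (dist-refl _))) (𝟙-nonNegative _)
      ... | no ¬q = ≤-trans (dist≤1 _ _) (≤-reflexive (sym (𝟙-true (plan-alive S s , ¬q))))

      dying-load : ∀ x → load (plan S) x * dying x ≤ a * dying x
      dying-load x with em {Alive w x × ¬ Alive w′ x}
      ... | yes (q , _) = *-monoˡ-≤ 0≤1 (plan-load S q)
      ... | no  _       = ≤-reflexive (trans (zeroʳ _) (sym (zeroʳ _)))

      moves : sum (λ s → dist (position S s) (g s)) ≤ detour S + a * deaths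
      moves = begin
        sum (λ s → dist (position S s) (g s))
          -- Each seed is routed through its old plan: the first leg is the recorded detour, and the
          -- second costs something only if the planned state is dying.
          ≤⟨ sum-mono-≤ {n} (λ s → ≤-trans (dist-triangle _ (plan S s) _) (+-mono-≤ ≤-refl (moved s))) ⟩
        sum (λ s → dist (position S s) (plan S s) + dying (plan S s))
          ≡⟨ ∑-distrib-+ {n} _ _ ⟩
        detour S + sum (λ s → dying (plan S s))
          ≤⟨ +-mono-≤ ≤-refl (sum-load-≤ (plan S) dying dying-load) ⟩
        detour S + a * deaths ∎

      alive-load : ∀ x → load g x * (𝟙 (Alive w′ x) * excess x) ≤ a′ * (𝟙 (Alive w′ x) * excess x)
      alive-load x with em {Alive w′ x}
      ... | yes q = *-monoˡ-≤ (subst (0# ≤_) (sym (*-identityˡ _)) (excess≥0 x)) (g-load q)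
      ... | no  _ = ≤-reflexive (trans (cong (load g x *_) (zeroˡ _))
                      (trans (zeroʳ _) (sym (trans (cong (a′ *_) (zeroˡ _)) (zeroʳ _)))))

      service : sum (λ s → excess (g s)) ≤ a′ * aliveSum w′ excess
      service = ≤-trans
        (≤-reflexive (sum-cong-≗ {n} (λ s →
          sym (trans (cong (_* excess (g s)) (𝟙-true (g-alive s))) (*-identityˡ _)))))
        (sum-load-≤ g (λ x → 𝟙 (Alive w′ x) * excess x) alive-load)

      Nμ≤ : N * μ ≤ N * (α * μ)
      Nμ≤ = N*≤N*α* (v≥0 cheapest)
    online-step {S} {v} {o} (restart _) v≥0 {p} bound = begin
      p + stepCost (position S) (const cheapest) v + sum (λ s → dist cheapest s) + (b₀ + b₀)
        -- The old phase is settled by `online≤`. The unit by which `lower` grows is worth `N * α`,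
        -- which pays for the move to the cheapest state, the new detour and two fresh budgets.
        ≤⟨ +-mono-≤ (+-mono-≤ (+-mono-≤ (online≤ S bound) cost≤) (sum-dist≤N (const cheapest) id))
                    (+-mono-≤ b₀≤ b₀≤) ⟩
      allowance S + (N + N * (α * μ)) + N + (budget n + budget n)
        ≡⟨ solve 4 (λ k u t b → k :+ (u :+ t) :+ u :+ (b :+ b) := (k :+ t) :+ ((u :+ u) :+ (b :+ b))) refl
             (allowance S) N (N * (α * μ)) (budget n) ⟩
      allowance S + N * (α * μ) + ((N + N) + (budget n + budget n))
        ≤⟨ +-mono-≤ ≤-refl phase≤α ⟩
      allowance S + N * (α * μ) + N * α
        ≡⟨ cong (λ c → allowance S + N * (α * μ) + N * c) (*-identityʳ α) ⟨
      allowance S + N * (α * μ) + N * (α * 1#)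
        ≡⟨ solve 6 (λ b k h l u o →
             (b :+ k :* (h :* l)) :+ k :* (h :* u) :+ k :* (h :* o) := b :+ k :* (h :* (l :+ u :+ o))) refl
             (budget n + budget n) N α (lower S) μ 1# ⟩
      budget n + budget n + N * (α * (lower S + μ + 1#))
        ≤⟨ x≤x+y (*-nonNegative (loadBound-nonNegative (alive w₀)) (aliveSum-nonNegative w₀ (λ _ → ≤-refl))) ⟩
      budget n + budget n + N * (α * (lower S + μ + 1#)) + loadBound (alive w₀) * aliveSum w₀ w₀ ∎
      where
      open Offset o
      μ = v cheapest
      -- Here each seed pays only the minimum `μ`, so the excess that ends the phase is never
      -- charged.
      cost≤ : stepCost (position S) (const cheapest) v ≤ N + N * (α * μ)
      cost≤ = ≤-trans (≤-reflexive (∑-distrib-+ {n} _ _))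
        (+-mono-≤ (sum-dist≤N (position S) (const cheapest))
          (≤-trans (≤-reflexive (sum-const n μ)) (N*≤N*α* (v≥0 cheapest))))

-- Sums of suprema in the extended reals

module Suprema (em : ExcludedMiddle 0ℓ) (F : CompleteOrderedField) where
  open CompleteOrderedField F
  open OrderedFieldProperties F
  open ExtendedReals em F

  sup-least : ∀ P (ne : Satisfiable P) {b} → UpperBound P b → sup P ne ≤⁺ [ b ]
  sup-least P ne ub with em {Satisfiable (UpperBound P)}
  ... | yes bounded  = [ proj₂ (proj₂ (complete P ne bounded)) ub ]
  ... | no unbounded = ⊥-elim (unbounded (_ , ub))

  -- Only reals can be subtracted, so the hypothesis keeps the possibly infinite `y` alone on its
  -- side. A single element of `P` already shows that `y` is finite.
  sup-+⁺-least : ∀ P (ne : Satisfiable P) y {b} → (∀ {x} → P x → y ≤⁺ [ b + - x ]) →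
                 sup P ne +⁺ y ≤⁺ [ b ]
  sup-+⁺-least P (x , Px) ⊤⁺ bound with () ← bound Px
  sup-+⁺-least P ne [ y ] {b} bound
    with sup P ne | sup-least P ne {b + - y} (λ Px → swap (bound Px))
    where
    swap : ∀ {x} → [ y ] ≤⁺ [ b + - x ] → x ≤ b + - y
    swap [ y≤b-x ] = +-≤⇒≤-difference (subst (_≤ b) (+-comm _ _) (≤-difference⇒+-≤ y≤b-x))
  ... | [ x ] | [ x≤b-y ] = [ subst (_≤ b) (+-comm y x) (≤-difference⇒+-≤ x≤b-y) ]

  Terms : (ℕ → ℝ) → Pred ℝ 0ℓ
  Terms p x = ∃ λ t → x ≡ p t

  -- Fixing a time for the first sequence moves its term into the bound on the others, so the
  -- suprema are peeled off one by one.
  sum-sup-independent : ∀ {k} (p : Fin k → ℕ → ℝ) (ne : ∀ s → Satisfiable (Terms (p s))) {b} →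
    (∀ (T : Fin k → ℕ) → sum (λ s → p s (T s)) ≤ b) →
    sum⁺ (λ s → sup (Terms (p s)) (ne s)) ≤⁺ [ b ]
  sum-sup-independent {zero}  p ne bound = [ bound (λ ()) ]
  sum-sup-independent {suc k} p ne {b} bound = sup-+⁺-least (Terms (p zero)) (ne zero) _ tail≤
    where
    tail≤ : ∀ {x} → Terms (p zero) x → sum⁺ (λ s → sup (Terms (p (suc s))) (ne (suc s))) ≤⁺ [ b + - x ]
    tail≤ (t , refl) = sum-sup-independent (p ∘ suc) (ne ∘ suc) λ T →
      +-≤⇒≤-difference (bound λ where
        zero    → t
        (suc s) → T s)

  common-bound : ∀ {k} (T : Fin k → ℕ) → ∃ λ t → ∀ s → T s ≤ℕ t
  common-bound {zero}  T = 0 , λ ()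
  common-bound {suc k} T with common-bound (T ∘ suc)
  ... | t , T≤t = T zero ⊔ t , λ where
    zero    → m≤m⊔n (T zero) t
    (suc s) → ≤ℕ-trans (T≤t s) (m≤n⊔m (T zero) t)

  increasing : ∀ {p : ℕ → ℝ} → (∀ t → p t ≤ p (suc t)) → ∀ {t u} → t ≤ℕ u → p t ≤ p u
  increasing {p} p-suc t≤u = go (≤⇒≤′ t≤u)
    where
    go : ∀ {t u} → t ≤′ u → p t ≤ p u
    go ≤′-refl       = ≤-refl
    go (≤′-step t≤u) = ≤-trans (go t≤u) (p-suc _)

  -- The online analysis bounds all seeds at one common time, while each cost is its own supremum.
  -- Monotonicity lets independent times be raised to a common one.
  sum-sup-least : ∀ {k} (p : Fin k → ℕ → ℝ) (ne : ∀ s → Satisfiable (Terms (p s))) {b} →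
    (∀ s t → p s t ≤ p s (suc t)) → (∀ t → sum (λ s → p s t) ≤ b) →
    sum⁺ (λ s → sup (Terms (p s)) (ne s)) ≤⁺ [ b ]
  sum-sup-least {k} p ne p-suc bound = sum-sup-independent p ne λ T →
    let t , T≤t = common-bound T
    in ≤-trans (sum-mono-≤ {k} (λ s → increasing (p-suc s) (T≤t s))) (bound t)

-- Transfer to the uniform metric space and competitiveness

module UniformSpace (em : ExcludedMiddle 0ℓ) (F : CompleteOrderedField)
  {n : ℕ} (x₀ : Fin n) (M : MTS.FiniteMetricSpace em F n) (uniform : MTS.IsUniform em F M) where
  open MTS em F
  open CompleteOrderedField F
  open OrderedFieldProperties F
  open ExtendedReals em F
  open AddSupremum _≤_ using (≤⁺-trans; [≤]-injective)
  open Suprema em F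
  open Budget F n using (budget)
  open Algorithm em F n x₀
  open State
  open FiniteMetricSpace M
  open Inverse cardinality using (to; from; strictlyInverseʳ)
  open Metric.IsGeneralMetric isMetric using (nonNegative; ≈⇒0; triangle)

  d≤1 : ∀ x y → d x y ≤ 1#
  d≤1 x y with em {x ≡ y}
  ... | yes x≡y = ≤-trans (≤-reflexive (≈⇒0 x≡y)) 0≤1
  ... | no  x≢y = ≤-reflexive (uniform x≢y)

  open Accounting (λ i j → d (from i) (from j)) (λ _ → ≈⇒0 refl) (λ _ _ → nonNegative)
    (λ _ _ → d≤1 _ _) (λ _ _ _ → triangle _ _ _)

  run : List (CostVector M) → State
  run = foldl (λ S v → advance S (v ∘ from)) (fresh id 0#)

  algorithm : BarelyRandomAlgorithm M n
  algorithm cs s = from (position (run cs) s)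

  module _ (c : CostSequence M) where

    state : ℕ → State
    state T = run (applyUpTo c T)

    state-step : ∀ T → Step (state T) (offset (c T ∘ from)) (state (suc T))
    -- `applyUpTo` unfolds at the front of the list, whereas the newest vector is the last one.
    state-step T = subst (Step (state T) (offset (c T ∘ from)))
      (trans (sym (foldl-∷ʳ _ (fresh id 0#) (c T) (applyUpTo c T))) (cong run (applyUpTo-∷ʳ c T)))
      (proj₂ (step (state T) (offset (c T ∘ from))))

    offline-bound : ∀ ρ T → OfflineBound (state T) (to (ρ T)) (partialCost M ρ c T)
    offline-bound ρ zero    = inj₂ (≤-reflexive (+-identityʳ 0#))
    -- `offline-step` charges the vector at `from (to x)`, the partial cost at `x` itself.
    offline-bound ρ (suc T) = subst
      (λ x → OfflineBound (state (suc T)) (to (ρ (suc T)))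
               (partialCost M ρ c T + (d (ρ T) (ρ (suc T)) + c T x)))
      (strictlyInverseʳ (ρ (suc T)))
      (offline-step (state-step T) (offline-bound ρ T) nonNegative moved)
      where
      moved : to (ρ T) ≡ to (ρ (suc T)) ⊎ d (ρ T) (ρ (suc T)) ≡ 1#
      moved with em {ρ T ≡ ρ (suc T)}
      ... | yes eq = inj₁ (cong to eq)
      ... | no  ¬eq = inj₂ (uniform ¬eq)

    -- `OPT` is a supremum of real lower bounds, so it suffices that `lower (state T)` is below the
    -- partial cost of every schedule at time `T`.
    lower≤OPT : ∀ T → [ lower (state T) ] ≤⁺ OPT M c
    lower≤OPT T = sup-upper _ _ λ ρ → ≤⁺-trans ≤-trans
      [ lower≤ (state T) (offline-bound ρ T) ] (sup-upper _ _ (T , refl))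

    module _ (c≥0 : NonNegative M c) where

      onlineCost : Fin n → ℕ → ℝ
      onlineCost s = partialCost M (output M algorithm c s) c

      online-bound : ∀ T → OnlineBound (state T) (sum (λ s → onlineCost s T))
      online-bound zero    = subst (OnlineBound (state 0)) (sym (sum-replicate-zero n)) online-start
      online-bound (suc T) = subst (OnlineBound (state (suc T))) (sym (∑-distrib-+ {n} _ _))
        (online-step (state-step T) (λ x → c≥0 T (from x)) (online-bound T))

      onlineCost-suc : ∀ s T → onlineCost s T ≤ onlineCost s (suc T)
      onlineCost-suc s T = x≤x+y (+-nonNegative nonNegative (c≥0 T _))

      N≢0 : N ≢ 0#
      N≢0 = nonzero x₀
        where
        nonzero : ∀ {k} → Fin k → fromℕ k ≢ 0#
        nonzero {suc k} _ = fromℕ-suc≢0 k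

      -- The two budgets granted in advance for the first phase, shared among the seeds. Its value
      -- does not depend on `c`, so it can serve as the additive constant for all cost sequences.
      constant : ℝ
      constant = N ⁻¹ * (budget n + budget n)

      totalCost≤ : ∀ {v} → (∀ T → lower (state T) ≤ v) →
        sum⁺ (λ s → Cost M (output M algorithm c s) c) ≤⁺ [ budget n + budget n + N * (α * v) ]
      totalCost≤ lower≤v = sum-sup-least onlineCost (λ _ → 0# , 0 , refl) onlineCost-suc λ T → ≤-trans
        (online≤ (state T) (online-bound T))
        (+-mono-≤ ≤-refl (*-monoʳ-≤ (fromℕ-nonNegative n) (*-monoʳ-≤ 0≤α (lower≤v T))))

      rescale : ∀ {x v} → x ≤⁺ [ budget n + budget n + N * (α * v) ] →
                N ⁻¹ *⁺ x ≤⁺ [ α * v + constant ]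
      rescale {v = v} ([_] {k = x} x≤) = [ (begin
        N ⁻¹ * x
          ≤⟨ *-monoʳ-≤ (⁻¹-nonNegative (fromℕ-nonNegative n) N≢0) x≤ ⟩
        N ⁻¹ * (budget n + budget n + N * (α * v))
          ≡⟨ distribˡ _ _ _ ⟩
        constant + N ⁻¹ * (N * (α * v))
          ≡⟨ cong (constant +_) (⁻¹-cancel N≢0 (α * v)) ⟩
        constant + α * v
          ≡⟨ +-comm _ _ ⟩
        α * v + constant ∎) ]

      expectedCost≤ : ∀ v → (∀ T → [ lower (state T) ] ≤⁺ v) →
                      expectedCost M algorithm c ≤⁺ α *⁺ v +⁺ [ constant ]
      expectedCost≤ ⊤⁺    _       = _ ≤⊤⁺
      expectedCost≤ [ v ] lower≤v = rescale (totalCost≤ (λ T → [≤]-injective (lower≤v T)))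

      competitive : expectedCost M algorithm c ≤⁺ α *⁺ OPT M c +⁺ [ constant ]
      competitive = expectedCost≤ (OPT M c) lower≤OPT

proposition4p1 : (em : ExcludedMiddle 0ℓ) (F : CompleteOrderedField) →
    let open CompleteOrderedField F
        open MTS em F
    in (n : ℕ) → 1 ≤ℕ n → (M : FiniteMetricSpace n) → IsUniform M →
       ∃ λ (A : BarelyRandomAlgorithm M n) → IsCompetitive M A (fromℕ 2 * H n + fromℕ 6)
proposition4p1 em F n 1≤n M uniform = algorithm , _ , competitive
  where open UniformSpace em F (fromℕ< 1≤n) M uniform
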